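{- Let $G$ be a finite simple graph and let $u,v,w,z$ be vertices such that the pivot sequence $[uv][wz]$ is applicable to $G$. Write $(p_1,p_2,p_3,p_4)=(u,v,w,z)$. Then for all vertices $x,y$ of $G$, $$x\sim_{G[uv][wz]}y \;=\; (x\sim_G y)\;\oplus\bigoplus_{\substack{\{i,j\}\subseteq\{1,2,3,4\},\ i\neq j\\ p_i\sim_G p_j}}\Big(\big((x\sim_G p_k)\wedge(y\sim_G p_l)\big)\oplus\big((x\sim_G p_l)\wedge(y\sim_G p_k)\big)\Big),$$ where for each 2-element set $\{i,j\}$, $\{k,l\}=\{1,2,3,4\}\setminus\{i,j\}$.
   Context: $x\sim_H y$ holds iff $\{x,y\}\in E(H)$ or $x=y$; statements are Boolean-valued and $\oplus$ is exclusive or. Pivot: for an edge $\{a,b\}$, with $N'(x)=N(x)\cup\{x\}$, $V_1=N'(a)\setminus N'(b)$, $V_2=N'(b)\setminus N'(a)$, $V_3=N'(a)\cap N'(b)$, the graph $G[ab]$ is obtained by toggling every pair $\{x,y\}$ with $x\in V_i$, $y\in V_j$, $i\neq j$. The sequence $[uv][wz]$ is applicable to $G$ if $\{u,v\}\in E(G)$ and $\{w,z\}\in E(G[uv])$; $G[uv][wz]$ is the resulting graph. -}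

module Defs where

open import Data.Bool using (Bool; true; false; _∧_; _∨_; not; _xor_; if_then_else_)
open import Data.Nat using (ℕ)
open import Data.Fin using (Fin)
open import Data.Fin.Properties using (_≟_)
open import Data.List using (List; []; _∷_; foldr)
open import Data.Product using (_×_; _,_)
open import Relation.Binary.PropositionalEquality using (_≡_)
open import Relation.Nullary.Decidable using (⌊_⌋)

record SimpleGraph (n : ℕ) : Set where
  field
    adj    : Fin n → Fin n → Bool
    sym    : ∀ x y → adj x y ≡ adj y x
    irrefl : ∀ x → adj x x ≡ false
open SimpleGraph public

Adj : ℕ → Set
Adj n = Fin n → Fin n → Bool

sim : ∀ {n} → Adj n → Fin n → Fin n → Bool
sim A x y = A x y ∨ ⌊ x ≟ y ⌋

inN' : ∀ {n} → Adj n → Fin n → Fin n → Bool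
inN' A a x = sim A a x

data Part : Set where
  V₁ V₂ V₃ none : Part

part : ∀ {n} → Adj n → Fin n → Fin n → Fin n → Part
part A a b x with inN' A a x | inN' A b x
... | true  | false = V₁
... | false | true  = V₂
... | true  | true  = V₃
... | false | false = none

differentParts : Part → Part → Bool
differentParts V₁ V₂ = true
differentParts V₁ V₃ = true
differentParts V₂ V₁ = true
differentParts V₂ V₃ = true
differentParts V₃ V₁ = true
differentParts V₃ V₂ = true
differentParts _  _  = false

pivot : ∀ {n} → Adj n → Fin n → Fin n → Adj n
pivot A a b x y = A x y xor differentParts (part A a b x) (part A a b y)

Applicable : ∀ {n} → SimpleGraph n → Fin n → Fin n → Fin n → Fin n → Set
Applicable G u v w z = (adj G u v ≡ true) × (pivot (adj G) u v w z ≡ true)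

⨁ : List Bool → Bool
⨁ = foldr _xor_ false

pairTerm : ∀ {n} → Adj n → Fin n → Fin n → (Fin n × Fin n) → (Fin n × Fin n) → Bool
pairTerm A x y (pi , pj) (pk , pl) =
  sim A pi pj ∧ ((sim A x pk ∧ sim A y pl) xor (sim A x pl ∧ sim A y pk))

rhs : ∀ {n} → Adj n → Fin n → Fin n → Fin n → Fin n → Fin n → Fin n → Bool
rhs A p₁ p₂ p₃ p₄ x y =
  sim A x y xor ⨁ ( pairTerm A x y (p₁ , p₂) (p₃ , p₄)
                  ∷ pairTerm A x y (p₁ , p₃) (p₂ , p₄)
                  ∷ pairTerm A x y (p₁ , p₄) (p₂ , p₃)
                  ∷ pairTerm A x y (p₂ , p₃) (p₁ , p₄)
                  ∷ pairTerm A x y (p₂ , p₄) (p₁ , p₃)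
                  ∷ pairTerm A x y (p₃ , p₄) (p₁ , p₂)
                  ∷ [])

{-# OPTIONS --safe #-}

-- The form a_x b_y + b_x a_y over F₂ vanishes exactly when (a_x , b_x) and
-- (a_y , b_y) are dependent, so pivoting adds (x ~ a)(y ~ b) + (x ~ b)(y ~ a)
-- to x ~ y.  Applying this formula twice gives a polynomial identity over F₂,
-- once the two applicability equations have been used to replace u ~ v by 1 and
-- w ~ z by 1 + (u ~ w)(v ~ z) + (v ~ w)(u ~ z).
module Submission where

open import Defs
open import Data.Bool using (true; false; _∧_; _∨_; _xor_)
open import Data.Bool.Solver using (module xor-∧-Solver)
open import Data.Nat using (ℕ)
open import Data.Fin using (Fin)
open import Data.Fin.Properties using (_≟_)
open import Data.Product using (_,_)
open import Relation.Binary.PropositionalEquality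
  using (_≡_; refl; cong; trans)
  renaming (sym to ≡-sym)
open import Relation.Nullary using (yes; no; contradiction)
open import Relation.Nullary.Decidable using (⌊_⌋)

open xor-∧-Solver

adj⇒sim : ∀ {n} (A : Adj n) {x y} → A x y ≡ true → sim A x y ≡ true
adj⇒sim A {x} {y} = cong (_∨ ⌊ x ≟ y ⌋)

sim-sym : ∀ {n} (G : SimpleGraph n) x y → sim (adj G) x y ≡ sim (adj G) y x
sim-sym G x y with x ≟ y | y ≟ x
... | yes _    | yes _    = cong (_∨ true) (SimpleGraph.sym G x y)
... | no _     | no _     = cong (_∨ false) (SimpleGraph.sym G x y)
... | yes refl | no x≢x   = contradiction refl x≢x
... | no x≢x   | yes refl = contradiction refl x≢x

-- The parts `V₁`, `V₂`, `V₃` are the three nonzero vectors of F₂² and `none` is the zero vector.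
-- Over F₂ two vectors are independent iff they are nonzero and distinct, so the right side is a 2×2
-- determinant.
differentParts-part : ∀ {n} (A : Adj n) a b x y →
  differentParts (part A a b x) (part A a b y)
    ≡ (sim A a x ∧ sim A b y) xor (sim A b x ∧ sim A a y)
differentParts-part A a b x y
  with sim A a x | sim A b x | sim A a y | sim A b y
... | true  | true  | true  | true  = refl
... | true  | true  | true  | false = refl
... | true  | true  | false | true  = refl
... | true  | true  | false | false = refl
... | true  | false | true  | true  = refl
... | true  | false | true  | false = refl
... | true  | false | false | true  = refl
... | true  | false | false | false = refl
... | false | true  | true  | true  = refl
... | false | true  | true  | false = refl
... | false | true  | false | true  = refl
... | false | true  | false | false = refl
... | false | false | true  | true  = refl
... | false | false | true  | false = refl
... | false | false | false | true  = refl
... | false | false | false | false = refl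

differentParts-irrefl : ∀ p → differentParts p p ≡ false
differentParts-irrefl V₁   = refl
differentParts-irrefl V₂   = refl
differentParts-irrefl V₃   = refl
differentParts-irrefl none = refl

∨-xor-comm : ∀ a d → (a xor d) ∨ false ≡ (a ∨ false) xor d
∨-xor-comm false false = refl
∨-xor-comm false true  = refl
∨-xor-comm true  false = refl
∨-xor-comm true  true  = refl

-- Off the diagonal `sim` is plain adjacency. On the diagonal both sides are true, because a vertex
-- shares its part with itself and nothing is toggled.
sim-pivot-parts : ∀ {n} (A : Adj n) a b x y →
  sim (pivot A a b) x y ≡ sim A x y xor differentParts (part A a b x) (part A a b y)
sim-pivot-parts A a b x y with x ≟ y
... | no _ = ∨-xor-comm (A x y) (differentParts (part A a b x) (part A a b y))
... | yes refl rewrite differentParts-irrefl (part A a b x) = ∨-true (A x x)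
  where
  ∨-true : ∀ c → (c xor false) ∨ true ≡ (c ∨ true) xor false
  ∨-true false = refl
  ∨-true true  = refl

sim-pivot : ∀ {n} (A : Adj n) a b x y →
  sim (pivot A a b) x y ≡ sim A x y xor ((sim A a x ∧ sim A b y) xor (sim A b x ∧ sim A a y))
sim-pivot A a b x y =
  trans (sim-pivot-parts A a b x y) (cong (sim A x y xor_) (differentParts-part A a b x y))

xor≡true⇒ : ∀ a d → a xor d ≡ true → a ≡ true xor d
xor≡true⇒ false true  _ = refl
xor≡true⇒ true  false _ = refl

-- Here `xᵢ`, `yᵢ` stand for x ~ pᵢ, y ~ pᵢ and `mᵢⱼ` for pᵢ ~ pⱼ. In the expanded product the terms
-- in `x₁ ∧ y₁` and `x₂ ∧ y₂` cancel in pairs. What is left on `(x₁ ∧ y₂) xor (x₂ ∧ y₁)` joins the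
-- first pivot's contribution to give the coefficient that replaces m₃₄. The leading `true` is m₁₂,
-- and the final `false` is the base of the fold in `⨁`.
double-pivot-identity : ∀ s x₁ x₂ x₃ x₄ y₁ y₂ y₃ y₄ m₁₃ m₁₄ m₂₃ m₂₄ →
  (s xor ((x₁ ∧ y₂) xor (x₂ ∧ y₁))) xor
    (((x₃ xor ((m₁₃ ∧ x₂) xor (m₂₃ ∧ x₁))) ∧ (y₄ xor ((m₁₄ ∧ y₂) xor (m₂₄ ∧ y₁)))) xor
     ((x₄ xor ((m₁₄ ∧ x₂) xor (m₂₄ ∧ x₁))) ∧ (y₃ xor ((m₁₃ ∧ y₂) xor (m₂₃ ∧ y₁)))))
  ≡ s xor
    ((true ∧ ((x₃ ∧ y₄) xor (x₄ ∧ y₃))) xor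
    ((m₁₃  ∧ ((x₂ ∧ y₄) xor (x₄ ∧ y₂))) xor
    ((m₁₄  ∧ ((x₂ ∧ y₃) xor (x₃ ∧ y₂))) xor
    ((m₂₃  ∧ ((x₁ ∧ y₄) xor (x₄ ∧ y₁))) xor
    ((m₂₄  ∧ ((x₁ ∧ y₃) xor (x₃ ∧ y₁))) xor
    (((true xor ((m₁₃ ∧ m₂₄) xor (m₂₃ ∧ m₁₄))) ∧ ((x₁ ∧ y₂) xor (x₂ ∧ y₁))) xor
    false))))))
double-pivot-identity = solve 13
  (λ s x₁ x₂ x₃ x₄ y₁ y₂ y₃ y₄ m₁₃ m₁₄ m₂₃ m₂₄ →
    (s :+ ((x₁ :* y₂) :+ (x₂ :* y₁))) :+
      (((x₃ :+ ((m₁₃ :* x₂) :+ (m₂₃ :* x₁))) :* (y₄ :+ ((m₁₄ :* y₂) :+ (m₂₄ :* y₁)))) :+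
       ((x₄ :+ ((m₁₄ :* x₂) :+ (m₂₄ :* x₁))) :* (y₃ :+ ((m₁₃ :* y₂) :+ (m₂₃ :* y₁)))))
    := s :+
      ((con true :* ((x₃ :* y₄) :+ (x₄ :* y₃))) :+
      ((m₁₃ :* ((x₂ :* y₄) :+ (x₄ :* y₂))) :+
      ((m₁₄ :* ((x₂ :* y₃) :+ (x₃ :* y₂))) :+
      ((m₂₃ :* ((x₁ :* y₄) :+ (x₄ :* y₁))) :+
      ((m₂₄ :* ((x₁ :* y₃) :+ (x₃ :* y₁))) :+
      (((con true :+ ((m₁₃ :* m₂₄) :+ (m₂₃ :* m₁₄))) :* ((x₁ :* y₂) :+ (x₂ :* y₁))) :+
      con false)))))))
  refl

theorem11 : (n : ℕ) (G : SimpleGraph n) (u v w z : Fin n) →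
    Applicable G u v w z →
    (x y : Fin n) →
    sim (pivot (pivot (adj G) u v) w z) x y ≡ rhs (adj G) u v w z x y
theorem11 n G u v w z (uv , wz) x y
  rewrite sim-pivot (pivot (adj G) u v) w z x y
        -- The outer pivot leaves five relations of G[uv], each now expanded over G.
        | sim-pivot (adj G) u v x y
        | sim-pivot (adj G) u v w x
        | sim-pivot (adj G) u v z y
        | sim-pivot (adj G) u v z x
        | sim-pivot (adj G) u v w y
        -- `rhs` has x and y on the left of each relation, the pivot formula on the right.
        | sim-sym G x u | sim-sym G x v | sim-sym G x w | sim-sym G x z
        | sim-sym G y u | sim-sym G y v | sim-sym G y w | sim-sym G y z
        | adj⇒sim (adj G) uv
        -- The pivot formula at (w, z) turns the second applicability condition into an equation
        -- over G, solved here for w ~ z.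
        | xor≡true⇒ (sim (adj G) w z) _
            (trans (≡-sym (sim-pivot (adj G) u v w z)) (adj⇒sim (pivot (adj G) u v) wz))
  = double-pivot-identity (sim (adj G) x y)
      (sim (adj G) u x) (sim (adj G) v x) (sim (adj G) w x) (sim (adj G) z x)
      (sim (adj G) u y) (sim (adj G) v y) (sim (adj G) w y) (sim (adj G) z y)
      (sim (adj G) u w) (sim (adj G) u z) (sim (adj G) v w) (sim (adj G) v z)
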